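{- Let $G$ be a threshold graph (with at least one vertex) and let $D$ be an orientation of $G$. Then $D$ has a vertex $v$ with $d^{+}_D(v)\le d^{++}_D(v)$.
   Context: Graphs are finite and simple. An orientation of $G$ is the digraph obtained by replacing each edge of $G$ by exactly one of its two possible arcs. For a vertex $v$ of $D$, $N^{+}_D(v)$ is the set of out-neighbors of $v$ and $d^{+}_D(v)=|N^{+}_D(v)|$. $N^{++}_D(v)$ is the set of vertices at distance exactly 2 from $v$ (out-neighbors of out-neighbors of $v$, excluding $N^{+}_D(v)$); $d^{++}_D(v)=|N^{++}_D(v)|$. A graph $G$ is a threshold graph if, for some $n\ge 0$: (1) $V(G)=\bigcup_{i=1}^{n+1}(X_i\cup A_{i-1})$ with the $A_i$'s and $X_i$'s pairwise disjoint; (2) $K=\bigcup_{i=1}^{n+1}X_i$ is a clique and the $X_i$'s are nonempty, except possibly $X_{n+1}$; (3) $S=\bigcup_{i=0}^{n}A_i$ is a stable set and the $A_i$'s are nonempty, except possibly $A_0$; (4) for all $1\le j\le i\le n$, every vertex of $A_i$ is adjacent to every vertex of $X_j$; (5) $G$ has no other edges. Equivalently (Chvátal–Hammer), $G$ has no induced subgraph isomorphic to $C_4$, $\overline{C_4}$ or $P_4$ (the path on 4 vertices). -}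

module Defs where

open import Data.Fin.Base using (Fin; zero; toℕ)
open import Data.Fin.Properties using (any?) renaming (_≟_ to _≟ᶠ_)
open import Data.Fin.Subset using (Subset; _∈_; ∣_∣; Nonempty)
open import Data.Nat.Base using (ℕ; suc; _<_)
open import Data.Product.Base using (∃; ∃₂; _×_)
open import Data.Sum.Base using (_⊎_)
open import Data.Vec.Base using (tabulate)
open import Level using (0ℓ)
open import Relation.Binary.Core using (Rel)
open import Relation.Binary.Definitions using (Decidable; Symmetric)
open import Relation.Binary.PropositionalEquality using (_≢_)
open import Relation.Nullary using (¬_; does; _×-dec_; ¬?)
import Relation.Unary as U

record Graph (n : ℕ) : Set₁ where
  infix 4 _∼_ _∼?_
  field
    _∼_      : Rel (Fin n) 0ℓ
    _∼?_     : Decidable _∼_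
    ∼-sym    : Symmetric _∼_
    ∼-irrefl : ∀ u → ¬ (u ∼ u)

record Digraph (n : ℕ) : Set₁ where
  infix 4 _⟶_ _⟶?_
  field
    _⟶_  : Rel (Fin n) 0ℓ
    _⟶?_ : Decidable _⟶_

record IsOrientation {n : ℕ} (G : Graph n) (D : Digraph n) : Set where
  open Graph G
  open Digraph D
  field
    arc⇒edge : ∀ {u v} → u ⟶ v → u ∼ v
    edge⇒arc : ∀ {u v} → u ∼ v → (u ⟶ v × ¬ (v ⟶ u)) ⊎ (v ⟶ u × ¬ (u ⟶ v))

comprehension : ∀ {n} {P : U.Pred (Fin n) 0ℓ} → U.Decidable P → Subset n
comprehension P? = tabulate (λ w → does (P? w))

module _ {n : ℕ} (D : Digraph n) where
  open Digraph D

  N⁺ : Fin n → Subset n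
  N⁺ v = comprehension (v ⟶?_)

  d⁺ : Fin n → ℕ
  d⁺ v = ∣ N⁺ v ∣

  AtDistance2 : Rel (Fin n) 0ℓ
  AtDistance2 v w = w ≢ v × ¬ (v ⟶ w) × ∃ λ u → v ⟶ u × u ⟶ w

  atDistance2? : Decidable AtDistance2
  atDistance2? v w =
    ¬? (w ≟ᶠ v) ×-dec ¬? (v ⟶? w) ×-dec any? (λ u → (v ⟶? u) ×-dec (u ⟶? w))

  N⁺⁺ : Fin n → Subset n
  N⁺⁺ v = comprehension (atDistance2? v)

  d⁺⁺ : Fin n → ℕ
  d⁺⁺ v = ∣ N⁺⁺ v ∣

-- The classes are X₁, …, X_{m+1} and A₀, …, A_m.  Both families are indexed
-- by Fin (suc m): the class X_{j+1} is X j, whereas A_i is A i.  Hence the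
-- condition 1 ≤ j ≤ i ≤ m on the pair (A_i , X_j) becomes toℕ j < toℕ i.
record IsThreshold {n : ℕ} (G : Graph n) : Set where
  open Graph G
  field
    m : ℕ
    X : Fin (suc m) → Subset n
    A : Fin (suc m) → Subset n

  InK : U.Pred (Fin n) 0ℓ
  InK v = ∃ λ j → v ∈ X j

  InS : U.Pred (Fin n) 0ℓ
  InS v = ∃ λ i → v ∈ A i

  Joined : Rel (Fin n) 0ℓ
  Joined a x = ∃₂ λ i j → toℕ j < toℕ i × a ∈ A i × x ∈ X j

  field
    cover       : ∀ v → InK v ⊎ InS v
    X-disjoint  : ∀ {i j v} → i ≢ j → v ∈ X i → ¬ (v ∈ X j)
    A-disjoint  : ∀ {i j v} → i ≢ j → v ∈ A i → ¬ (v ∈ A j)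
    XA-disjoint : ∀ {i j v} → v ∈ X i → ¬ (v ∈ A j)

    K-clique   : ∀ {u v} → InK u → InK v → u ≢ v → u ∼ v
    X-nonempty : ∀ j → toℕ j < m → Nonempty (X j)

    S-stable   : ∀ {u v} → InS u → InS v → ¬ (u ∼ v)
    A-nonempty : ∀ i → i ≢ zero → Nonempty (A i)

    joined⇒edge : ∀ {a x} → Joined a x → a ∼ x

    no-other-edges : ∀ {u v} → u ∼ v →
                     (InK u × InK v) ⊎ Joined u v ⊎ Joined v u

{-# OPTIONS --safe #-}

-- Call x → y "convenient" when every in-neighbour of x reaches y in at most two
-- steps.  Every arc is convenient, and since a threshold graph has no alternating
-- 4-cycle, any two distinct vertices are convenient in at least one direction.
-- The Havet–Thomassé median order argument is run on this semicomplete relation,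
-- but with first and second out-neighbourhoods taken in D itself: for a feed
-- vertex f, no vertex beyond distance 2 from f is convenient from an
-- out-neighbour of f, so it dominates all of these out-neighbours.
module Submission where

open import Defs
open import Data.Empty using (⊥; ⊥-elim)
open import Data.Fin.Base using (Fin; zero; suc; toℕ)
open import Data.Fin.Properties using (all?; any?; ¬∀⟶∃¬)
open import Data.Fin.Subset using (∣_∣)
open import Data.List.Base using (List; []; _∷_; [_]; _++_; length; filter; allFin; tabulate)
open import Data.List.Properties using (filter-++; length-++; filter-reject)
open import Data.List.Relation.Binary.Permutation.Propositional
  using (_↭_; ↭-refl; ↭-trans; prep)
open import Data.List.Relation.Binary.Permutation.Propositional.Properties
  using (↭-length; filter-↭; shift)
open import Data.List.Relation.Unary.All as All using (All; []; _∷_)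
open import Data.Nat.Base using (ℕ; zero; suc; NonZero; _+_; _≤_; _<_; z≤n; s≤s)
open import Data.Nat.Induction using (Acc; acc; <-wellFounded)
open import Data.Nat.Properties
  using (_<?_; _≤?_; ≤-trans; m≤n⇒m≤1+n; ≮⇒≥; <⇒≤; <-≤-trans; 0≢1+n;
         +-mono-≤; +-monoˡ-≤; +-cancelˡ-≤; module ≤-Reasoning)
open import Data.Nat.Tactic.RingSolver using (solve-∀)
open import Data.Product.Base using (∃; ∃₂; _×_; _,_; proj₁; proj₂)
open import Data.Sum.Base using (_⊎_; inj₁; inj₂; [_,_]′)
open import Function.Base using (_∘_)
open import Level using (0ℓ)
open import Relation.Binary.Core using (Rel)
open import Relation.Binary.Definitions using (Decidable)
open import Relation.Binary.PropositionalEquality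
  using (_≡_; _≢_; refl; trans; cong; cong₂; subst; subst₂; module ≡-Reasoning)
open import Relation.Nullary using (¬_; yes; no; _→-dec_; _⊎-dec_)
open import Relation.Nullary.Decidable using (decidable-stable)
import Relation.Unary as U

-- Counting the entries of a list that satisfy a predicate

module _ {B : Set} where

  count : {P : U.Pred B 0ℓ} → U.Decidable P → List B → ℕ
  count P? xs = length (filter P? xs)

  count-++ : {P : U.Pred B 0ℓ} (P? : U.Decidable P) (xs ys : List B) →
             count P? (xs ++ ys) ≡ count P? xs + count P? ys
  count-++ P? xs ys = trans (cong length (filter-++ P? xs ys)) (length-++ (filter P? xs))

  count-↭ : {P : U.Pred B 0ℓ} (P? : U.Decidable P) {xs ys : List B} →
            xs ↭ ys → count P? xs ≡ count P? ys
  count-↭ P? p = ↭-length (filter-↭ P? p)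

  count-mono : {P Q : U.Pred B 0ℓ} (P? : U.Decidable P) (Q? : U.Decidable Q) {xs : List B} →
               All (λ x → P x → Q x) xs → count P? xs ≤ count Q? xs
  count-mono P? Q? [] = z≤n
  count-mono P? Q? {x ∷ xs} (pq ∷ pqs) with P? x | Q? x | count-mono P? Q? pqs
  ... | yes _ | yes _ | ih = s≤s ih
  ... | yes p | no ¬q | ih = ⊥-elim (¬q (pq p))
  ... | no _  | yes _ | ih = m≤n⇒m≤1+n ih
  ... | no _  | no _  | ih = ih

  count-tabulate : ∀ {n} {P : U.Pred B 0ℓ} (P? : U.Decidable P) (f : Fin n → B) →
                   count P? (tabulate f) ≡ ∣ comprehension (P? ∘ f) ∣
  count-tabulate {zero}  P? f = refl
  count-tabulate {suc n} P? f with P? (f zero) | count-tabulate P? (f ∘ suc)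
  ... | yes _ | ih = cong suc ih
  ... | no _  | ih = ih

-- Median orders and the feed vertex

module MedianOrder {V : Set} {_⇒_ : Rel V 0ℓ} (_⇒?_ : Decidable _⇒_) where

  -- Lists are read in decreasing order, so that the feed vertex is the head.
  backArcs : List V → ℕ
  backArcs []       = 0
  backArcs (x ∷ xs) = count (x ⇒?_) xs + backArcs xs

  IsMedian : List V → Set
  IsMedian xs = ∀ {ys} → ys ↭ xs → backArcs xs ≤ backArcs ys

  -- Well-founded descent on `backArcs`: a list that is not median has a permutation with fewer back
  -- arcs. Double negation avoids deciding `IsMedian` and suffices for a decidable goal.
  ¬¬median : ∀ xs → ¬ ¬ ∃ λ zs → zs ↭ xs × IsMedian zs
  ¬¬median xs = go xs (<-wellFounded (backArcs xs))
    where
    go : ∀ xs → Acc _<_ (backArcs xs) → ¬ ¬ ∃ λ zs → zs ↭ xs × IsMedian zs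
    go xs (acc rs) k = k (xs , ↭-refl , λ {ys} ys↭xs → ≮⇒≥ λ lt →
      go ys (rs lt) λ (zs , zs↭ys , med) → k (zs , ↭-trans zs↭ys ys↭xs , med))

  median-tail : ∀ {x xs} → IsMedian (x ∷ xs) → IsMedian xs
  median-tail {x} {xs} med {ys} ys↭xs = +-cancelˡ-≤ (count (x ⇒?_) xs) _ _
    (subst (λ c → count (x ⇒?_) xs + backArcs xs ≤ c + backArcs ys)
           (count-↭ (x ⇒?_) ys↭xs) (med (prep x ys↭xs)))

  count-single : ∀ x y → count (x ⇒?_) [ y ] ≡ count (_⇒? y) [ x ]
  count-single x y with x ⇒? y
  ... | yes _ = refl
  ... | no _  = refl

  -- Moving `x` behind `ps` affects only the pairs of `x` with `ps`. Both corrections are added, so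
  -- that no subtraction on `ℕ` occurs.
  backArcs-shift : ∀ x ps qs →
    backArcs (ps ++ x ∷ qs) + count (x ⇒?_) ps ≡
    backArcs (x ∷ ps ++ qs) + count (_⇒? x) ps
  backArcs-shift x []       qs = refl
  backArcs-shift x (p ∷ ps) qs = begin
    (count (p ⇒?_) (ps ++ x ∷ qs) + B₁) + count (x ⇒?_) (p ∷ ps)
      -- The same vertices follow `p` wherever `x` stands, so the pair of `p` and `x` can be split
      -- off from its count.
      ≡⟨ cong₂ (λ s t → (s + B₁) + t)
           (trans (count-↭ (p ⇒?_) (shift x ps qs))
             (trans (count-++ (p ⇒?_) [ x ] (ps ++ qs)) (cong (_+ d) (count-single p x))))
           (count-++ (x ⇒?_) [ p ] ps) ⟩
    ((a + d) + B₁) + (b + k)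
      ≡⟨ regroup a d B₁ b k ⟩
    (B₁ + k) + (a + d + b)
      ≡⟨ cong (_+ (a + d + b)) (backArcs-shift x ps qs) ⟩
    ((c + e) + l) + (a + d + b)
      ≡⟨ regroup′ a d b c e l ⟩
    ((b + c) + (d + e)) + (a + l)
      ≡⟨ cong₂ (λ s t → (s + (d + e)) + t)
           (count-++ (x ⇒?_) [ p ] (ps ++ qs)) (count-++ (_⇒? x) [ p ] ps) ⟨
    backArcs (x ∷ p ∷ ps ++ qs) + count (_⇒? x) (p ∷ ps) ∎
    where
    open ≡-Reasoning
    B₁ = backArcs (ps ++ x ∷ qs)
    a = count (_⇒? x) [ p ]
    b = count (x ⇒?_) [ p ]
    c = count (x ⇒?_) (ps ++ qs)
    d = count (p ⇒?_) (ps ++ qs)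
    e = backArcs (ps ++ qs)
    k = count (x ⇒?_) ps
    l = count (_⇒? x) ps
    regroup : ∀ a d B b k → ((a + d) + B) + (b + k) ≡ (B + k) + (a + d + b)
    regroup = solve-∀
    regroup′ : ∀ a d b c e l →
               ((c + e) + l) + (a + d + b) ≡ ((b + c) + (d + e)) + (a + l)
    regroup′ = solve-∀

  -- Otherwise moving `x` behind `ps` would lower the number of back arcs.
  median-feedback : ∀ x ps qs → IsMedian (x ∷ ps ++ qs) →
                    count (x ⇒?_) ps ≤ count (_⇒? x) ps
  median-feedback x ps qs med = +-cancelˡ-≤ (backArcs (x ∷ ps ++ qs)) _ _ (begin
    backArcs (x ∷ ps ++ qs) + count (x ⇒?_) ps
      ≤⟨ +-monoˡ-≤ (count (x ⇒?_) ps) (med (shift x ps qs)) ⟩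
    backArcs (ps ++ x ∷ qs) + count (x ⇒?_) ps
      ≡⟨ backArcs-shift x ps qs ⟩
    backArcs (x ∷ ps ++ qs) + count (_⇒? x) ps ∎)
    where open ≤-Reasoning

  module _ {Out Second : U.Pred V 0ℓ} (Out? : U.Decidable Out) (Second? : U.Decidable Second)
           (dominates : ∀ {x y} → ¬ (Out x ⊎ Second x) → Out y → x ⇒ y × ¬ (y ⇒ x)) where

    Near : U.Pred V 0ℓ
    Near x = Out x ⊎ Second x

    -- The far `x` sends an arc to each `Out` vertex of `ps` and receives none back, so any arc into
    -- `x` from `ps` starts in `Second`; the feedback inequality links the two counts.
    interval : ∀ {x ps} qs → IsMedian (x ∷ ps ++ qs) → ¬ Near x → All Near ps →
               count Out? ps ≤ count Second? ps
    interval {x} {ps} qs med far near = begin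
      count Out? ps     ≤⟨ count-mono Out? (x ⇒?_) (All.map (λ _ → proj₁ ∘ dominates far) near) ⟩
      count (x ⇒?_) ps  ≤⟨ median-feedback x ps qs med ⟩
      count (_⇒? x) ps  ≤⟨ count-mono (_⇒? x) Second? (All.map second near) ⟩
      count Second? ps  ∎
      where
      open ≤-Reasoning
      second : ∀ {y} → Near y → y ⇒ x → Second y
      second (inj₁ o) y⇒x = ⊥-elim (proj₂ (dominates far o) y⇒x)
      second (inj₂ s) _   = s

    -- The far vertices cut the order into intervals of near vertices; ps is the
    -- interval that has not been closed by a far vertex yet.
    split : ∀ xs → IsMedian xs → ∃₂ λ ps qs →
            xs ≡ ps ++ qs × All Near ps × count Out? qs ≤ count Second? qs
    split []       med = [] , [] , refl , [] , z≤n
    split (x ∷ xs) med with split xs (median-tail med) | Out? x ⊎-dec Second? x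
    ... | ps , qs , refl , near , le | yes nx = x ∷ ps , qs , refl , nx ∷ near , le
    ... | ps , qs , refl , near , le | no far = [] , x ∷ ps ++ qs , refl , [] , (begin
      count Out? (x ∷ ps ++ qs)            ≡⟨ cong length (filter-reject Out? (far ∘ inj₁)) ⟩
      count Out? (ps ++ qs)                ≡⟨ count-++ Out? ps qs ⟩
      count Out? ps + count Out? qs        ≤⟨ +-mono-≤ (interval qs med far near) le ⟩
      count Second? ps + count Second? qs  ≡⟨ count-++ Second? ps qs ⟨
      count Second? (ps ++ qs)             ≡⟨ cong length (filter-reject Second? (far ∘ inj₂)) ⟨
      count Second? (x ∷ ps ++ qs)         ∎)
      where open ≤-Reasoning

    -- A far head leaves no interval open, so the bound from `split` covers the whole list.
    median-feed : ∀ {x xs} → IsMedian (x ∷ xs) → ¬ Near x →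
                  count Out? (x ∷ xs) ≤ count Second? (x ∷ xs)
    median-feed {x} {xs} med far with split (x ∷ xs) med
    ... | []    , _ , refl , _      , le = le
    ... | _ ∷ _ , _ , refl , nx ∷ _ , _  = ⊥-elim (far nx)

-- Alternating 4-cycles in threshold graphs

module _ {n : ℕ} {G : Graph n} (threshold : IsThreshold G) where
  open Graph G
  open IsThreshold threshold

  stable-neighbour : ∀ {a x} → InS a → a ∼ x → Joined a x
  stable-neighbour {a} {x} (_ , a∈A) a∼x with no-other-edges a∼x
  ... | inj₁ ((_ , a∈X) , _)                  = ⊥-elim (XA-disjoint a∈X a∈A)
  ... | inj₂ (inj₁ joined)                    = joined
  ... | inj₂ (inj₂ (_ , _ , _ , _ , a∈X))     = ⊥-elim (XA-disjoint a∈X a∈A)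

  -- A vertex of `A i` sees exactly the classes `X j` with `j < i`, so the neighbourhoods of stable
  -- vertices form a chain under inclusion.
  alternating-stable : ∀ {a x y b} → InS a → InS b → a ∼ x → b ∼ y → a ∼ y ⊎ b ∼ x
  alternating-stable a∈S b∈S a∼x b∼y
    with stable-neighbour a∈S a∼x | stable-neighbour b∈S b∼y
  ... | i , j , j<i , a∈Aᵢ , x∈Xⱼ | k , l , l<k , b∈Aₖ , y∈Xₗ with toℕ l <? toℕ i
  ...   | yes l<i = inj₁ (joined⇒edge (i , l , l<i , a∈Aᵢ , y∈Xₗ))
  ...   | no  l≮i =
    inj₂ (joined⇒edge (k , j , <-≤-trans j<i (≤-trans (≮⇒≥ l≮i) (<⇒≤ l<k)) , b∈Aₖ , x∈Xⱼ))

  -- Unless `x`, `y` or `v`, `u` both lie in the clique, stability forces `x`, `u` or `v`, `y` to be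
  -- the two stable vertices, and their nested neighbourhoods give the edge.
  no-alternating-4-cycle : ∀ {x y v u} → x ≢ y → v ≢ u → v ∼ x → u ∼ y → x ∼ y ⊎ v ∼ u
  no-alternating-4-cycle {x} {y} {v} {u} x≢y v≢u v∼x u∼y
    with cover x | cover y | cover v | cover u
  ... | inj₁ x∈K | inj₁ y∈K | _        | _        = inj₁ (K-clique x∈K y∈K x≢y)
  ... | _        | _        | inj₁ v∈K | inj₁ u∈K = inj₂ (K-clique v∈K u∈K v≢u)
  ... | inj₂ x∈S | _        | inj₂ v∈S | _        = ⊥-elim (S-stable v∈S x∈S v∼x)
  ... | _        | inj₂ y∈S | _        | inj₂ u∈S = ⊥-elim (S-stable u∈S y∈S u∼y)
  ... | inj₂ x∈S | inj₁ _   | inj₁ _   | inj₂ u∈S =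
    [ inj₁ , inj₂ ∘ ∼-sym ]′ (alternating-stable x∈S u∈S (∼-sym v∼x) u∼y)
  ... | inj₁ _   | inj₂ y∈S | inj₂ v∈S | inj₁ _   =
    [ inj₂ , inj₁ ∘ ∼-sym ]′ (alternating-stable v∈S y∈S v∼x (∼-sym u∼y))

-- The convenience relation of a digraph

module Convenience {n : ℕ} (D : Digraph n) where
  open Digraph D

  Reaches : Rel (Fin n) 0ℓ
  Reaches v w = v ⟶ w ⊎ AtDistance2 D v w

  reaches? : Decidable Reaches
  reaches? v w = (v ⟶? w) ⊎-dec atDistance2? D v w

  Convenient : Rel (Fin n) 0ℓ
  Convenient x y = ∀ v → v ⟶ x → Reaches v y

  convenient? : Decidable Convenient
  convenient? x y = all? λ v → (v ⟶? x) →-dec reaches? v y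

  inconvenient : ∀ {x y} → ¬ Convenient x y → ∃ λ v → v ⟶ x × ¬ Reaches v y
  inconvenient {x} {y} ¬conv
    with v , ¬imp ← ¬∀⟶∃¬ n _ (λ v → (v ⟶? x) →-dec reaches? v y) ¬conv
    = v , decidable-stable (v ⟶? x) (λ ¬a → ¬imp (⊥-elim ∘ ¬a)) , λ r → ¬imp (λ _ → r)

-- Orientations of threshold graphs

module _ {n : ℕ} {G : Graph n} {D : Digraph n}
         (threshold : IsThreshold G) (orientation : IsOrientation G D) where
  open Graph G
  open Digraph D
  open IsOrientation orientation
  open Convenience D

  ⟶-asym : ∀ {u v} → u ⟶ v → ¬ (v ⟶ u)
  ⟶-asym u⟶v with edge⇒arc (arc⇒edge u⟶v)
  ... | inj₁ (_ , ¬v⟶u) = ¬v⟶u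
  ... | inj₂ (_ , ¬u⟶v) = ⊥-elim (¬u⟶v u⟶v)

  edge⇒arc′ : ∀ {u v} → u ∼ v → u ⟶ v ⊎ v ⟶ u
  edge⇒arc′ u∼v with edge⇒arc u∼v
  ... | inj₁ (u⟶v , _) = inj₁ u⟶v
  ... | inj₂ (v⟶u , _) = inj₂ v⟶u

  two-step : ∀ {u v w} → u ⟶ v → v ⟶ w → Reaches u w
  two-step {u} {v} {w} u⟶v v⟶w with u ⟶? w
  ... | yes u⟶w = inj₁ u⟶w
  ... | no ¬u⟶w = inj₂ ((λ { refl → ⟶-asym u⟶v v⟶w }) , ¬u⟶w , v , u⟶v , v⟶w)

  -- This makes the feed vertex itself far, as `median-feed` requires.
  ¬reaches-self : ∀ {v} → ¬ Reaches v v
  ¬reaches-self (inj₁ v⟶v)       = ⟶-asym v⟶v v⟶v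
  ¬reaches-self (inj₂ (v≢v , _)) = v≢v refl

  -- If both directions failed, the witnesses `v` and `u` with `x` and `y` would admit an edge
  -- between `x` and `y` or between `v` and `u`; either orientation of it completes a forbidden
  -- two-step path.
  convenient-total : ∀ {x y} → x ≢ y → ¬ Convenient y x → Convenient x y
  convenient-total {x} {y} x≢y ¬yx = decidable-stable (convenient? x y) λ ¬xy →
    clash (inconvenient ¬xy) (inconvenient ¬yx)
    where
    clash : (∃ λ v → v ⟶ x × ¬ Reaches v y) → (∃ λ u → u ⟶ y × ¬ Reaches u x) → ⊥
    clash (v , v⟶x , ¬v↝y) (u , u⟶y , ¬u↝x)
      -- A common witness is impossible: `v = u` would reach `y` by one arc.
      with no-alternating-4-cycle threshold x≢y (λ { refl → ¬v↝y (inj₁ u⟶y) })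
             (arc⇒edge v⟶x) (arc⇒edge u⟶y)
    ... | inj₁ x∼y = [ (λ x⟶y → ¬v↝y (two-step v⟶x x⟶y))
                     , (λ y⟶x → ¬u↝x (two-step u⟶y y⟶x)) ]′ (edge⇒arc′ x∼y)
    ... | inj₂ v∼u = [ (λ v⟶u → ¬v↝y (two-step v⟶u u⟶y))
                     , (λ u⟶v → ¬u↝x (two-step u⟶v v⟶x)) ]′ (edge⇒arc′ v∼u)

  open MedianOrder convenient?

  median-head-satisfies : ∀ {f xs} → f ∷ xs ↭ allFin n → IsMedian (f ∷ xs) →
                          d⁺ D f ≤ d⁺⁺ D f
  median-head-satisfies {f} {xs} perm med =
    subst₂ _≤_ (degree (f ⟶?_)) (degree (atDistance2? D f))
      (median-feed (f ⟶?_) (atDistance2? D f) dominates med ¬reaches-self)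
    where
    -- The list runs through every vertex exactly once, so counts along it are cardinalities of
    -- subsets.
    degree : ∀ {P : U.Pred (Fin n) 0ℓ} (P? : U.Decidable P) →
             count P? (f ∷ xs) ≡ ∣ comprehension P? ∣
    degree P? = trans (count-↭ P? perm) (count-tabulate P? (λ w → w))

    dominates : ∀ {x y} → ¬ Reaches f x → f ⟶ y → Convenient x y × ¬ Convenient y x
    dominates {x} {y} ¬f↝x f⟶y =
      convenient-total (λ { refl → ¬f↝x (inj₁ f⟶y) }) ¬yx , ¬yx
      where
      ¬yx : ¬ Convenient y x
      ¬yx conv = ¬f↝x (conv f f⟶y)

corollary7 : (n : ℕ) .{{_ : NonZero n}} (G : Graph n) (D : Digraph n) →
    IsThreshold G → IsOrientation G D →
    ∃ λ v → d⁺ D v ≤ d⁺⁺ D v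
corollary7 (suc n) G D threshold orientation =
  -- The goal is a decidable search over finitely many vertices, which discharges the double
  -- negation on the median order.
  decidable-stable (any? λ v → d⁺ D v ≤? d⁺⁺ D v) λ none →
  ¬¬median (allFin (suc n)) λ where
    ([]     , perm , _)   → 0≢1+n (↭-length perm)
    (f ∷ xs , perm , med) → none (f , median-head-satisfies threshold orientation perm med)
  where
  open MedianOrder (Convenience.convenient? D)
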